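{- $\mathrm{WL}_1\not\preceq\omega^{(2)}$: there exist graphs $G$ and $H$ with $\omega^{(2)}(G)=\omega^{(2)}(H)$ but $\mathrm{WL}_1(G)\ne\mathrm{WL}_1(H)$.
   Context: Graphs are finite, simple and undirected; an $n$-vertex graph has $V(G)=\{1,\dots,n\}$. Let $w_k(x,y)$ be the number of walks of length $k$ from $x$ to $y$ and $w_*(x,y)=(w_0(x,y),\dots,w_{n-1}(x,y))$. Define vertex colorings $\omega_0(x)=w_*(x,x)$ and $\omega_{r+1}(x)=\big(\omega_r(x),\{\!\{(w_*(x,y),\omega_r(y))\}\!\}_{y\in V(G)}\big)$, with $\{\!\{\cdot\}\!\}$ a multiset, and $\omega^{(r)}(G)=\{\!\{\omega_r(x)\}\!\}_{x\in V(G)}$. Color refinement (1-WL): $C^0(x)$ uniform (or the vertex color for colored graphs), $C^{r+1}(x)=\big(C^r(x),\{\!\{C^r(y)\}\!\}_{y\in N(x)}\big)$; $\mathrm{WL}_1(G)=\{\!\{C^n(x)\}\!\}_{x\in V(G)}$. -}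

module Defs where

open import Level using (0ℓ)
open import Data.Nat.Base using (ℕ; zero; suc)
open import Data.Fin.Base using (Fin)
open import Data.Fin.Properties using (_≟_)
open import Data.List.Base using (List; []; _∷_; [_]; map; filter; length; applyUpTo; allFin; cartesianProductWith)
open import Data.List.Relation.Binary.Pointwise.Base using (Pointwise; []; _∷_)
import Data.List.Relation.Binary.Permutation.Homogeneous as Perm
open import Data.List.Relation.Binary.Permutation.Setoid using (_↭_; ↭-setoid)
open import Data.Product.Base using (_×_; _,_)
open import Data.Product.Relation.Binary.Pointwise.NonDependent using (_×ₛ_)
open import Data.Vec.Base as Vec using (Vec)
open import Data.Vec.Relation.Unary.Linked using (Linked; linked?)
open import Relation.Binary.Bundles using (Setoid)
open import Relation.Binary.Core using (Rel)
open import Relation.Binary.Definitions using (Decidable; Symmetric; Irreflexive)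
open import Relation.Binary.PropositionalEquality using (_≡_)
import Relation.Binary.PropositionalEquality.Properties as ≡
open import Relation.Nullary.Decidable using (Dec; _×-dec_)

record Graph : Set₁ where
  infix 4 _~_ _~?_
  field
    order    : ℕ
    _~_      : Rel (Fin order) 0ℓ
    _~?_     : Decidable _~_
    ~-sym    : Symmetric _~_
    ~-irrefl : Irreflexive _≡_ _~_

  Vertex : Set
  Vertex = Fin order

  vertices : List Vertex
  vertices = allFin order

  N : Vertex → List Vertex
  N x = filter (x ~?_) vertices

------------------------------------------------------------------------
-- Walks

-- Every vector of length m over Fin n, each exactly once.
sequences : (n m : ℕ) → List (Vec (Fin n) m)
sequences n zero    = [ Vec.[] ]
sequences n (suc m) = cartesianProductWith Vec._∷_ (allFin n) (sequences n m)

module _ (G : Graph) where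
  open Graph G

  IsWalk : ∀ {k} → Vertex → Vertex → Vec Vertex (suc k) → Set
  IsWalk x y v = Vec.head v ≡ x × Vec.last v ≡ y × Linked _~_ v

  isWalk? : ∀ {k} (x y : Vertex) (v : Vec Vertex (suc k)) → Dec (IsWalk x y v)
  isWalk? x y v = (Vec.head v ≟ x) ×-dec (Vec.last v ≟ y) ×-dec linked? _~?_ v

  -- A walk of length k has k edges, hence k + 1 vertices.
  w : ℕ → Vertex → Vertex → ℕ
  w k x y = length (filter (isWalk? x y) (sequences order (suc k)))

  -- (w 0 x y , … , w (order - 1) x y)
  w⋆ : Vertex → Vertex → List ℕ
  w⋆ x y = applyUpTo (λ k → w k x y) order

------------------------------------------------------------------------
-- The colorings ω

-- A multiset over a setoid S is a list, with equality ↭ (permutation up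
-- to the equality of S).  The setoid of colors depends only on the round
-- r, so colors taken from different graphs can be compared.
ω-setoid : ℕ → Setoid 0ℓ 0ℓ
ω-setoid zero    = ≡.setoid (List ℕ)
ω-setoid (suc r) = ω-setoid r ×ₛ ↭-setoid (≡.setoid (List ℕ) ×ₛ ω-setoid r)

ω-Color : ℕ → Set
ω-Color r = Setoid.Carrier (ω-setoid r)

ω : (G : Graph) (r : ℕ) → Graph.Vertex G → ω-Color r
ω G zero    x = w⋆ G x x
ω G (suc r) x = ω G r x , map (λ y → w⋆ G x y , ω G r y) (Graph.vertices G)

ω⁽_⁾ : (r : ℕ) → Graph → List (ω-Color r)
ω⁽ r ⁾ G = map (ω G r) (Graph.vertices G)

infix 4 _≈ω⁽_⁾_

_≈ω⁽_⁾_ : Graph → ℕ → Graph → Set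
G ≈ω⁽ r ⁾ H = _↭_ (ω-setoid r) (ω⁽ r ⁾ G) (ω⁽ r ⁾ H)

------------------------------------------------------------------------
-- Color refinement

-- WL₁ runs for as many rounds as the graph has vertices, so the colors of
-- all rounds are put in one type; graphs of different orders then remain
-- comparable.
data CR-Color : Set where
  uniform : CR-Color
  refine  : CR-Color → List CR-Color → CR-Color

infix 4 _≈_

-- Equality of colors, the list in refine being read as a multiset.
data _≈_ : Rel CR-Color 0ℓ where
  uniform : uniform ≈ uniform
  refine  : ∀ {c d cs ds} → c ≈ d → Perm.Permutation _≈_ cs ds → refine c cs ≈ refine d ds

≈-refl : ∀ {c} → c ≈ c
≋-refl : ∀ {cs} → Pointwise _≈_ cs cs
≈-refl {uniform}     = uniform
≈-refl {refine c cs} = refine ≈-refl (Perm.refl ≋-refl)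
≋-refl {[]}     = []
≋-refl {c ∷ cs} = ≈-refl ∷ ≋-refl

≈-sym : Symmetric _≈_
≋-sym : Symmetric (Pointwise _≈_)
↭-sym : Symmetric (Perm.Permutation _≈_)
≈-sym uniform      = uniform
≈-sym (refine p q) = refine (≈-sym p) (↭-sym q)
≋-sym []       = []
≋-sym (p ∷ ps) = ≈-sym p ∷ ≋-sym ps
↭-sym (Perm.refl ps)    = Perm.refl (≋-sym ps)
↭-sym (Perm.prep p q)   = Perm.prep (≈-sym p) (↭-sym q)
↭-sym (Perm.swap p q r) = Perm.swap (≈-sym q) (≈-sym p) (↭-sym r)
↭-sym (Perm.trans p q)  = Perm.trans (↭-sym q) (↭-sym p)

≈-trans : ∀ {c d e} → c ≈ d → d ≈ e → c ≈ e
≈-trans uniform      uniform        = uniform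
≈-trans (refine p q) (refine p′ q′) = refine (≈-trans p p′) (Perm.trans q q′)

CR-setoid : Setoid 0ℓ 0ℓ
CR-setoid = record
  { Carrier       = CR-Color
  ; _≈_           = _≈_
  ; isEquivalence = record { refl = ≈-refl ; sym = ≈-sym ; trans = ≈-trans }
  }

C : (G : Graph) → ℕ → Graph.Vertex G → CR-Color
C G zero    x = uniform
C G (suc r) x = refine (C G r x) (map (C G r) (Graph.N G x))

WL₁ : Graph → List CR-Color
WL₁ G = map (C G (Graph.order G)) (Graph.vertices G)

infix 4 _≈WL₁_

_≈WL₁_ : Graph → Graph → Set
G ≈WL₁ H = _↭_ CR-setoid (WL₁ G) (WL₁ H)

{-# OPTIONS --safe #-}
module Submission where

-- The line graph L(K₇) is strongly regular.  Joining a new apex vertex to the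
-- set of edges of a graph F on 7 points perturbs its adjacency matrix by rank
-- two, so the walk counts between two vertices depend only on whether they are
-- equal or adjacent and on the colors that two rounds of color refinement give
-- them.  The colorings ω_r are then at most two rounds ahead of color
-- refinement, and it is enough to choose two graphs F that color refinement
-- separates slowly: a triangle and a square joined by a bridge, and a 7-cycle
-- with a chord (the two differ by switching a pair of edges).
--
-- Both halves are certified by evaluating one family of invariants of color
-- refinement: h₀ = 1 and h_{r+1}(x) = Σ_{z ∈ N(x)} h_r(z)².  On these graphs
-- h_{r+2}(x) determines ω_r(x) for r ≤ 2, and the multisets of the values of h₄
-- coincide, while Σ_x h₆(x) differs.

open import Defs hiding (↭-sym)
open import Level using (0ℓ)
open import Data.Bool.Base using (Bool; true; false; if_then_else_; _∧_; _∨_; _xor_; T)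
open import Data.Bool.ListAction using (any)
import Data.Bool.Properties as Bool
open import Data.Fin.Base using (Fin; zero; suc)
open import Data.Fin.Properties using (_≟_; all?)
open import Data.List.Base using (List; []; _∷_; [_]; _++_; map; filter; length; applyUpTo; upTo; iterate; allFin; tabulate; cartesianProductWith)
import Data.List.Properties as List
open import Data.List.Relation.Binary.Pointwise.Base using (Pointwise; []; _∷_)
import Data.List.Relation.Binary.Permutation.Homogeneous as Perm
open import Data.List.Relation.Binary.Permutation.Propositional using (_↭_; ↭-refl; ↭-sym; ↭-trans; prep; swap; ↭⇒↭ₛ′; ↭ₛ⇒↭)
open import Data.List.Relation.Binary.Permutation.Propositional.Properties using (map⁺; ↭-map-inv)
import Data.List.Relation.Binary.Permutation.Setoid as PermSetoid
import Data.List.Relation.Binary.Permutation.Setoid.Properties as PermSetoid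
open import Data.Maybe.Base as Maybe using (Maybe; just; nothing; maybe′)
open import Data.Nat.Base using (ℕ; zero; suc; _+_; _*_; _^_; _≡ᵇ_)
open import Data.Nat.ListAction using (sum)
open import Data.Nat.ListAction.Properties using (sum-↭; sum-++)
import Data.Nat.Properties as ℕ
open import Data.Product.Base using (∃₂; _×_; _,_; proj₁; proj₂; uncurry)
import Data.Product.Properties as Product
open import Data.Product.Relation.Binary.Pointwise.NonDependent using (_×ₛ_)
open import Data.Unit.Base using (tt)
open import Data.Vec.Base as Vec using (Vec; lookup)
import Data.Vec.Properties as Vec
open import Data.Vec.Relation.Unary.Linked using ([-]; _∷_)
open import Function.Base using (_∘_; id)
open import Relation.Binary.Bundles using (Setoid)
open import Relation.Binary.Definitions using (DecidableEquality)
open import Relation.Binary.PropositionalEquality using (_≡_; _≢_; _≗_; refl; sym; trans; cong; cong₂; subst; module ≡-Reasoning)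
import Relation.Binary.PropositionalEquality.Properties as ≡
open import Relation.Nullary using (¬_)
open import Relation.Nullary.Decidable using (Dec; yes; no; does; from-no; map′; _×-dec_; _→-dec_; toWitness; T?; dec-true; dec-false)
open import Relation.Unary using (Pred) renaming (Decidable to Decidable₁)

private
  variable
    A B D : Set

-- Sums over lists

∑ : List A → (A → ℕ) → ℕ
∑ xs f = sum (map f xs)

∑-cong : ∀ {f g : A → ℕ} → f ≗ g → ∀ xs → ∑ xs f ≡ ∑ xs g
∑-cong f≗g xs = cong sum (List.map-cong f≗g xs)

∑-zero : ∀ (xs : List A) → ∑ xs (λ _ → 0) ≡ 0
∑-zero []       = refl
∑-zero (_ ∷ xs) = ∑-zero xs

∑-distrib-+ : ∀ (xs : List A) f g → ∑ xs (λ x → f x + g x) ≡ ∑ xs f + ∑ xs g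
∑-distrib-+ []       f g = refl
∑-distrib-+ (x ∷ xs) f g = begin
  (f x + g x) + ∑ xs (λ x → f x + g x)  ≡⟨ cong (f x + g x +_) (∑-distrib-+ xs f g) ⟩
  (f x + g x) + (∑ xs f + ∑ xs g)       ≡⟨ interchange (f x) (g x) (∑ xs f) (∑ xs g) ⟩
  (f x + ∑ xs f) + (g x + ∑ xs g)       ∎
  where
  open ≡-Reasoning
  open import Algebra.Properties.CommutativeSemigroup ℕ.+-commutativeSemigroup using (interchange)

*-distribˡ-∑ : ∀ c (xs : List A) f → ∑ xs (λ x → c * f x) ≡ c * ∑ xs f
*-distribˡ-∑ c []       f = sym (ℕ.*-zeroʳ c)
*-distribˡ-∑ c (x ∷ xs) f = trans (cong (c * f x +_) (*-distribˡ-∑ c xs f))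
  (sym (ℕ.*-distribˡ-+ c (f x) (∑ xs f)))

∑-comm : ∀ (xs : List A) (ys : List B) (f : A → B → ℕ) →
  ∑ xs (λ x → ∑ ys (f x)) ≡ ∑ ys (λ y → ∑ xs (λ x → f x y))
∑-comm []       ys f = sym (∑-zero ys)
∑-comm (x ∷ xs) ys f = trans (cong (∑ ys (f x) +_) (∑-comm xs ys f))
  (sym (∑-distrib-+ ys (f x) (λ y → ∑ xs (λ x → f x y))))

∑-cartesianProductWith : ∀ (f : A → B → D) xs ys g →
  ∑ (cartesianProductWith f xs ys) g ≡ ∑ xs (λ x → ∑ ys (λ y → g (f x y)))
∑-cartesianProductWith f []       ys g = refl
∑-cartesianProductWith f (x ∷ xs) ys g = begin
  sum (map g (map (f x) ys ++ cartesianProductWith f xs ys))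
    ≡⟨ cong sum (List.map-++ g (map (f x) ys) _) ⟩
  sum (map g (map (f x) ys) ++ map g (cartesianProductWith f xs ys))
    ≡⟨ sum-++ (map g (map (f x) ys)) _ ⟩
  ∑ (map (f x) ys) g + ∑ (cartesianProductWith f xs ys) g
    ≡⟨ cong₂ _+_ (cong sum (sym (List.map-∘ ys))) (∑-cartesianProductWith f xs ys g) ⟩
  ∑ ys (λ y → g (f x y)) + ∑ xs (λ x → ∑ ys (λ y → g (f x y))) ∎
  where open ≡-Reasoning

-- The induction needs a general `g`, since `allFin (suc n)` continues with `tabulate suc` rather
-- than with `allFin n`.
∑-tabulate-single : ∀ {n} (g : Fin n → A) (f : A → ℕ) i →
  (∀ j → j ≢ i → f (g j) ≡ 0) → ∑ (tabulate g) f ≡ f (g i)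
∑-tabulate-single g f zero    z = begin
  f (g zero) + ∑ (tabulate (g ∘ suc)) f  ≡⟨ cong (f (g zero) +_) (vanish (g ∘ suc) (λ j → z (suc j) λ ())) ⟩
  f (g zero) + 0                         ≡⟨ ℕ.+-identityʳ _ ⟩
  f (g zero)                             ∎
  where
  open ≡-Reasoning
  vanish : ∀ {m} (g : Fin m → _) → (∀ j → f (g j) ≡ 0) → ∑ (tabulate g) f ≡ 0
  vanish {zero}  g z = refl
  vanish {suc m} g z = cong₂ _+_ (z zero) (vanish (g ∘ suc) (z ∘ suc))
∑-tabulate-single g f (suc i) z = cong₂ _+_ (z zero λ ())
  (∑-tabulate-single (g ∘ suc) f i λ j j≢i → z (suc j) λ { refl → j≢i refl })

∑-allFin-single : ∀ {n} (f : Fin n → ℕ) i → (∀ j → j ≢ i → f j ≡ 0) → ∑ (allFin n) f ≡ f i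
∑-allFin-single = ∑-tabulate-single id

-- Indicators and sums over filtered lists

𝟙 : Dec A → ℕ
𝟙 a? = if does a? then 1 else 0

𝟙-true : (a? : Dec A) → A → 𝟙 a? ≡ 1
𝟙-true a? a = cong (if_then 1 else 0) (dec-true a? a)

𝟙-false : (a? : Dec A) → ¬ A → 𝟙 a? ≡ 0
𝟙-false a? ¬a = cong (if_then 1 else 0) (dec-false a? ¬a)

𝟙-cong : (a? : Dec A) (b? : Dec B) → (A → B) → (B → A) → 𝟙 a? ≡ 𝟙 b?
𝟙-cong a? (yes b) f g = 𝟙-true a? (g b)
𝟙-cong a? (no ¬b) f g = 𝟙-false a? (¬b ∘ f)

𝟙-× : (a? : Dec A) (b? : Dec B) → 𝟙 (a? ×-dec b?) ≡ 𝟙 a? * 𝟙 b?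
𝟙-× (yes _) b? = sym (ℕ.*-identityˡ (𝟙 b?))
𝟙-× (no _)  b? = refl

module _ {P : Pred A 0ℓ} (P? : Decidable₁ P) where

  length-filter-∑ : ∀ xs → length (filter P? xs) ≡ ∑ xs (λ x → 𝟙 (P? x))
  length-filter-∑ []       = refl
  length-filter-∑ (x ∷ xs) with does (P? x)
  ... | true  = cong suc (length-filter-∑ xs)
  ... | false = length-filter-∑ xs

  ∑-filter : ∀ xs f → ∑ (filter P? xs) f ≡ ∑ xs (λ x → 𝟙 (P? x) * f x)
  ∑-filter []       f = refl
  ∑-filter (x ∷ xs) f with does (P? x)
  ... | true  = cong₂ _+_ (sym (ℕ.*-identityˡ (f x))) (∑-filter xs f)
  ... | false = ∑-filter xs f

-- Counting walks

module _ (G : Graph) where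
  open Graph G

  w-∑ : ∀ k x y → w G k x y ≡ ∑ (sequences order (suc k)) (λ v → 𝟙 (isWalk? G x y v))
  w-∑ k x y = length-filter-∑ (isWalk? G x y) (sequences order (suc k))

  w-zero : ∀ x y → w G 0 x y ≡ 𝟙 (x ≟ y)
  w-zero x y = begin
    w G 0 x y
      ≡⟨ w-∑ 0 x y ⟩
    ∑ (sequences order 1) (λ v → 𝟙 (isWalk? G x y v))
      ≡⟨ ∑-cartesianProductWith Vec._∷_ vertices [ Vec.[] ] _ ⟩
    ∑ vertices (λ a → 𝟙 (isWalk? G x y (a Vec.∷ Vec.[])) + 0)
      -- A one-entry walk starts at `a`, so only `a = x` contributes; `+ 0` ends the sum over the
      -- single empty tail.
      ≡⟨ ∑-allFin-single _ x (λ a a≢x → cong (_+ 0) (𝟙-false (isWalk? G x y (a Vec.∷ Vec.[])) (a≢x ∘ proj₁))) ⟩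
    𝟙 (isWalk? G x y (x Vec.∷ Vec.[])) + 0
      ≡⟨ ℕ.+-identityʳ _ ⟩
    𝟙 (isWalk? G x y (x Vec.∷ Vec.[]))
      ≡⟨ 𝟙-cong (isWalk? G x y (x Vec.∷ Vec.[])) (x ≟ y) (λ (_ , x≡y , _) → x≡y) (λ x≡y → refl , x≡y , [-]) ⟩
    𝟙 (x ≟ y) ∎
    where open ≡-Reasoning

  -- Both sums have a single nonzero term, at a = x and at z = head v.
  walk-prepend : ∀ {k} x y (v : Vec Vertex (suc k)) →
    ∑ vertices (λ a → 𝟙 (isWalk? G x y (a Vec.∷ v))) ≡ ∑ vertices (λ z → 𝟙 (x ~? z) * 𝟙 (isWalk? G z y v))
  walk-prepend x y v = begin
    ∑ vertices (λ a → 𝟙 (isWalk? G x y (a Vec.∷ v)))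
      ≡⟨ ∑-allFin-single _ x (λ a a≢x → 𝟙-false (isWalk? G x y (a Vec.∷ v)) (a≢x ∘ proj₁)) ⟩
    𝟙 (isWalk? G x y (x Vec.∷ v))
      ≡⟨ 𝟙-cong (isWalk? G x y (x Vec.∷ v)) ((x ~? h) ×-dec isWalk? G h y v)
           (λ { (_ , l , x~h ∷ r) → x~h , refl , l , r })
           (λ (x~h , _ , l , r) → refl , l , x~h ∷ r) ⟩
    𝟙 ((x ~? h) ×-dec isWalk? G h y v)
      ≡⟨ 𝟙-× (x ~? h) (isWalk? G h y v) ⟩
    𝟙 (x ~? h) * 𝟙 (isWalk? G h y v)
      ≡⟨ ∑-allFin-single _ h (λ z z≢h → trans
           (cong (𝟙 (x ~? z) *_) (𝟙-false (isWalk? G z y v) (z≢h ∘ sym ∘ proj₁)))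
           (ℕ.*-zeroʳ (𝟙 (x ~? z)))) ⟨
    ∑ vertices (λ z → 𝟙 (x ~? z) * 𝟙 (isWalk? G z y v)) ∎
    where
    open ≡-Reasoning
    h = Vec.head v

  -- Splitting off the first step is the matrix identity A^(k+1) = A A^k. It allows walk counts to
  -- be computed by iteration instead of by listing all vertex sequences.
  w-suc : ∀ k x y → w G (suc k) x y ≡ ∑ (N x) (λ z → w G k z y)
  w-suc k x y = begin
    w G (suc k) x y
      ≡⟨ w-∑ (suc k) x y ⟩
    ∑ (sequences order (suc (suc k))) (λ v → 𝟙 (isWalk? G x y v))
      ≡⟨ ∑-cartesianProductWith Vec._∷_ vertices seqs _ ⟩
    ∑ vertices (λ a → ∑ seqs (λ v → 𝟙 (isWalk? G x y (a Vec.∷ v))))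
      -- With the tail `v` fixed, the first vertex is summed innermost, where `walk-prepend` trades
      -- it for a neighbour `z` of `x`.
      ≡⟨ ∑-comm vertices seqs _ ⟩
    ∑ seqs (λ v → ∑ vertices (λ a → 𝟙 (isWalk? G x y (a Vec.∷ v))))
      ≡⟨ ∑-cong (walk-prepend x y) seqs ⟩
    ∑ seqs (λ v → ∑ vertices (λ z → 𝟙 (x ~? z) * 𝟙 (isWalk? G z y v)))
      ≡⟨ ∑-comm seqs vertices _ ⟩
    ∑ vertices (λ z → ∑ seqs (λ v → 𝟙 (x ~? z) * 𝟙 (isWalk? G z y v)))
      ≡⟨ ∑-cong (λ z → *-distribˡ-∑ (𝟙 (x ~? z)) seqs _) vertices ⟩
    ∑ vertices (λ z → 𝟙 (x ~? z) * ∑ seqs (λ v → 𝟙 (isWalk? G z y v)))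
      ≡⟨ ∑-cong (λ z → cong (𝟙 (x ~? z) *_) (sym (w-∑ k z y))) vertices ⟩
    ∑ vertices (λ z → 𝟙 (x ~? z) * w G k z y)
      ≡⟨ ∑-filter (x ~?_) vertices _ ⟨
    ∑ (N x) (λ z → w G k z y) ∎
    where
    open ≡-Reasoning
    seqs = sequences order (suc k)

-- An invariant of color refinement

-- At `C G r x` this counts the homomorphisms to `G`, with the root sent to `x`, of a rooted tree
-- T_r: T_0 is a point, and T_(r+1) is a new root with one child at which two copies of T_r are
-- glued by their roots. Without the square it would only count the walks of length `r` from `x`.
-- `homs` is spelled out to keep the recursion structural.
hom : CR-Color → ℕ
homs : List CR-Color → ℕ
hom uniform       = 1
hom (refine c cs) = homs cs
homs []       = 0
homs (c ∷ cs) = hom c ^ 2 + homs cs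

homs-∑ : ∀ cs → homs cs ≡ ∑ cs (λ c → hom c ^ 2)
homs-∑ []       = refl
homs-∑ (c ∷ cs) = cong (hom c ^ 2 +_) (homs-∑ cs)

hom-cong   : ∀ {c d} → c ≈ d → hom c ≡ hom d
homs-cong  : ∀ {cs ds} → Perm.Permutation _≈_ cs ds → homs cs ≡ homs ds
homs-cong′ : ∀ {cs ds} → Pointwise _≈_ cs ds → homs cs ≡ homs ds
hom-cong uniform      = refl
hom-cong (refine p q) = homs-cong q
homs-cong (Perm.refl ps)   = homs-cong′ ps
homs-cong (Perm.prep p q)  = cong₂ _+_ (cong (_^ 2) (hom-cong p)) (homs-cong q)
homs-cong {c ∷ c′ ∷ cs} {d′ ∷ d ∷ ds} (Perm.swap p p′ q) = begin
  hom c ^ 2 + (hom c′ ^ 2 + homs cs)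
    ≡⟨ cong₂ _+_ (cong (_^ 2) (hom-cong p)) (cong₂ _+_ (cong (_^ 2) (hom-cong p′)) (homs-cong q)) ⟩
  hom d ^ 2 + (hom d′ ^ 2 + homs ds)
    ≡⟨ x∙yz≈y∙xz (hom d ^ 2) (hom d′ ^ 2) (homs ds) ⟩
  hom d′ ^ 2 + (hom d ^ 2 + homs ds) ∎
  where
  open ≡-Reasoning
  open import Algebra.Properties.CommutativeSemigroup ℕ.+-commutativeSemigroup using (x∙yz≈y∙xz)
homs-cong (Perm.trans p q) = trans (homs-cong p) (homs-cong q)
homs-cong′ []       = refl
homs-cong′ (p ∷ ps) = cong₂ _+_ (cong (_^ 2) (hom-cong p)) (homs-cong′ ps)

-- `WL₁` compares colors after `order` rounds, whereas the invariant is evaluated at an earlier one.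
-- A color keeps its history, so the last `m` rounds can be undone. The value at `uniform` for
-- `suc m` is a default, never reached from `C G (m + r) x`.
previous : ℕ → CR-Color → CR-Color
previous zero    c            = c
previous (suc m) uniform      = uniform
previous (suc m) (refine c _) = previous m c

previous-cong : ∀ m {c d} → c ≈ d → previous m c ≈ previous m d
previous-cong zero    p            = p
previous-cong (suc m) uniform      = uniform
previous-cong (suc m) (refine p _) = previous-cong m p

previous-C : ∀ G m r x → previous m (C G (m + r) x) ≡ C G r x
previous-C G zero    r x = refl
previous-C G (suc m) r x = previous-C G m r x

h : (G : Graph) → ℕ → Graph.Vertex G → ℕ
h G r x = hom (C G r x)

h-suc : ∀ G r x → h G (suc r) x ≡ ∑ (Graph.N G x) (λ z → h G r z ^ 2)
h-suc G r x = trans (homs-∑ (map (C G r) (Graph.N G x)))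
  (cong sum (sym (List.map-∘ (Graph.N G x))))

WL₁⇒∑h : ∀ G H m r → Graph.order G ≡ m + r → Graph.order H ≡ m + r → G ≈WL₁ H →
  ∑ (Graph.vertices G) (h G r) ≡ ∑ (Graph.vertices H) (h H r)
WL₁⇒∑h G H m r eqG eqH p = begin
  ∑ (Graph.vertices G) (h G r)
    ≡⟨ total G eqG ⟨
  ∑ (WL₁ G) f
    ≡⟨ sum-↭ (↭ₛ⇒↭ (PermSetoid.map⁺ CR-setoid (≡.setoid ℕ) (hom-cong ∘ previous-cong m) p)) ⟩
  ∑ (WL₁ H) f
    ≡⟨ total H eqH ⟩
  ∑ (Graph.vertices H) (h H r) ∎
  where
  open ≡-Reasoning
  f : CR-Color → ℕ
  f = hom ∘ previous m
  -- The number of rounds is a variable `s` because `refl` cannot be matched at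
  -- `Graph.order K ≡ m + r`.
  total : ∀ K {s} → s ≡ m + r → ∑ (map (C K s) (Graph.vertices K)) f ≡ ∑ (Graph.vertices K) (h K r)
  total K refl = trans (cong sum (sym (List.map-∘ (Graph.vertices K))))
                       (∑-cong (λ x → cong hom (previous-C K m r x)) (Graph.vertices K))

-- Testing and transporting permutations

-- These tests return Booleans because pattern matching on a proof of equality
-- of two large numbers would evaluate it in unary.
module _ (_≟ᴬ_ : DecidableEquality A) where

  delete : A → List A → Maybe (List A)
  delete x []       = nothing
  delete x (y ∷ ys) = if does (x ≟ᴬ y) then just ys else Maybe.map (y ∷_) (delete x ys)

  isPermutation : List A → List A → Bool
  isPermutation []       []      = true
  isPermutation []       (_ ∷ _) = false
  isPermutation (x ∷ xs) ys      = maybe′ (isPermutation xs) false (delete x ys)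

  delete-↭ : ∀ x ys {zs} → delete x ys ≡ just zs → ys ↭ x ∷ zs
  delete-↭ x (y ∷ ys) eq with x ≟ᴬ y
  delete-↭ x (y ∷ ys) refl | yes refl = ↭-refl
  delete-↭ x (y ∷ ys) eq   | no _ with delete x ys in eq′
  delete-↭ x (y ∷ ys) refl | no _ | just zs = ↭-trans (prep y (delete-↭ x ys eq′)) (swap y x ↭-refl)

  isPermutation⇒↭ : ∀ xs ys → T (isPermutation xs ys) → xs ↭ ys
  isPermutation⇒↭ []       []      _ = ↭-refl
  -- At `nothing` the test is `false`, so `p` excludes that case.
  isPermutation⇒↭ (x ∷ xs) ys      p with just zs ← delete x ys in eq =
    ↭-trans (prep x (isPermutation⇒↭ xs zs p)) (↭-sym (delete-↭ x ys eq))

module _ (S : Setoid 0ℓ 0ℓ) where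
  open Setoid S using () renaming (Carrier to Color; _≈_ to _≈ˢ_)

  -- A permutation of the codes lifts to a rearrangement `zs` of `xs` whose codes agree entry by
  -- entry with those of `ys`; equal codes then give equal colors. The colors themselves are never
  -- evaluated.
  map-↭-transport : {A B D : Set} (f : A → D) (g : B → D) (F : A → Color) (G : B → Color) →
    (∀ a b → f a ≡ g b → F a ≈ˢ G b) → ∀ {xs ys} → map f xs ↭ map g ys →
    PermSetoid._↭_ S (map F xs) (map G ys)
  map-↭-transport {A = A} {B = B} f g F G f≡g⇒F≈G p with zs , eq , q ← ↭-map-inv f p =
    Perm.trans (↭⇒↭ₛ′ (Setoid.isEquivalence S) (map⁺ F q)) (Perm.refl (pointwise zs _ eq))
    where
    pointwise : ∀ (as : List A) (bs : List B) → map g bs ≡ map f as → Pointwise _≈ˢ_ (map F as) (map G bs)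
    pointwise []       []       eq = []
    pointwise (a ∷ as) (b ∷ bs) eq =
      f≡g⇒F≈G a b (sym (List.∷-injectiveˡ eq)) ∷ pointwise as bs (List.∷-injectiveʳ eq)

-- Tabulating walk counts and tree homomorphism counts

Table : Set → ℕ → Set
Table A n = Vec (Vec A n) n

entry : ∀ {n} → Table A n → Fin n → Fin n → A
entry t x y = lookup (lookup t x) y

iterate-applyUpTo : ∀ (f : A → A) (g : ℕ → A) → (∀ k → f (g k) ≡ g (suc k)) →
  ∀ n → iterate f (g 0) n ≡ applyUpTo g n
iterate-applyUpTo f g step zero    = refl
iterate-applyUpTo f g step (suc n) =
  cong (g 0 ∷_) (trans (cong (λ a → iterate f a n) (step 0)) (iterate-applyUpTo f (g ∘ suc) (step ∘ suc) n))

-- For `f = id` this is the adjacency matrix applied to `v`; for squaring it is one step of the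
-- recursion of `h`.
neighbourSums : ∀ {n} → Vec (List (Fin n)) n → (ℕ → ℕ) → Vec ℕ n → Vec ℕ n
neighbourSums nbrs f v = Vec.map (λ ns → ∑ ns (λ z → f (lookup v z))) nbrs

-- Column `y` of the powers A^0, ..., A^(n-1), starting from a standard basis vector.
walkColumn : ∀ {n} → Vec (List (Fin n)) n → Fin n → List (Vec ℕ n)
walkColumn {n} nbrs y = iterate (neighbourSums nbrs id) (Vec.tabulate (λ x → 𝟙 (x ≟ y))) n

-- The columns are an argument so that they are evaluated only once.
transposeColumns : ∀ {n} → Vec (List (Vec ℕ n)) n → Table (List ℕ) n
transposeColumns cols =
  Vec.tabulate λ x → Vec.tabulate λ y → map (λ col → lookup col x) (lookup cols y)

walkTable : ∀ {n} → Vec (List (Fin n)) n → Table (List ℕ) n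
walkTable nbrs = transposeColumns (Vec.tabulate (walkColumn nbrs))

homVector : ∀ {n} → Vec (List (Fin n)) n → ℕ → Vec ℕ n
homVector nbrs zero    = Vec.replicate _ 1
homVector nbrs (suc r) = neighbourSums nbrs (_^ 2) (homVector nbrs r)

module _ (G : Graph) where
  open Graph G

  neighbourhoods : Vec (List Vertex) order
  neighbourhoods = Vec.tabulate N

  walks : Table (List ℕ) order
  walks = walkTable neighbourhoods

  homCounts : ℕ → Vec ℕ order
  homCounts = homVector neighbourhoods

  neighbourSums-tabulate : ∀ f (φ : Vertex → ℕ) →
    neighbourSums neighbourhoods f (Vec.tabulate φ) ≡ Vec.tabulate (λ x → ∑ (N x) (f ∘ φ))
  neighbourSums-tabulate f φ = begin
    Vec.map _ (Vec.tabulate N)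
      ≡⟨ Vec.tabulate-∘ _ N ⟨
    Vec.tabulate (λ x → ∑ (N x) (λ z → f (lookup (Vec.tabulate φ) z)))
      ≡⟨ Vec.tabulate-cong (λ x → ∑-cong (λ z → cong f (Vec.lookup∘tabulate φ z)) (N x)) ⟩
    Vec.tabulate (λ x → ∑ (N x) (f ∘ φ)) ∎
    where open ≡-Reasoning

  walkColumn-w : ∀ y → walkColumn neighbourhoods y ≡ applyUpTo (λ k → Vec.tabulate (λ x → w G k x y)) order
  walkColumn-w y = trans
    (cong (λ v → iterate (neighbourSums neighbourhoods id) v order) (Vec.tabulate-cong (λ x → sym (w-zero G x y))))
    (iterate-applyUpTo _ _ (λ k → trans (neighbourSums-tabulate id _)
      (Vec.tabulate-cong (λ x → sym (w-suc G k x y)))) order)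

  walks-w⋆ : ∀ x y → entry walks x y ≡ w⋆ G x y
  walks-w⋆ x y = begin
    entry walks x y
      ≡⟨ cong (λ v → lookup v y) (Vec.lookup∘tabulate _ x) ⟩
    lookup (Vec.tabulate λ y → map (λ col → lookup col x) (lookup cols y)) y
      ≡⟨ Vec.lookup∘tabulate _ y ⟩
    map (λ col → lookup col x) (lookup cols y)
      ≡⟨ cong (map _) (trans (Vec.lookup∘tabulate (walkColumn neighbourhoods) y) (walkColumn-w y)) ⟩
    map (λ col → lookup col x) (applyUpTo (λ k → Vec.tabulate (λ x → w G k x y)) order)
      ≡⟨ List.map-applyUpTo _ _ order ⟩
    applyUpTo (λ k → lookup (Vec.tabulate (λ x → w G k x y)) x) order
      -- Passing through `upTo` lets `map-cong` rewrite the entries pointwise.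
      ≡⟨ List.map-upTo _ order ⟨
    map (λ k → lookup (Vec.tabulate (λ x → w G k x y)) x) (upTo order)
      ≡⟨ List.map-cong (λ k → Vec.lookup∘tabulate _ x) (upTo order) ⟩
    map (λ k → w G k x y) (upTo order)
      ≡⟨ List.map-upTo _ order ⟩
    w⋆ G x y ∎
    where
    open ≡-Reasoning
    cols = Vec.tabulate (walkColumn neighbourhoods)

  homCounts-h : ∀ r → homCounts r ≡ Vec.tabulate (h G r)
  homCounts-h zero    = replicate-tabulate
    where
    replicate-tabulate : ∀ {n} → Vec.replicate n 1 ≡ Vec.tabulate (λ _ → 1)
    replicate-tabulate {zero}  = refl
    replicate-tabulate {suc n} = cong (1 Vec.∷_) replicate-tabulate
  homCounts-h (suc r) = begin
    neighbourSums neighbourhoods (_^ 2) (homCounts r)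
      ≡⟨ cong (neighbourSums neighbourhoods (_^ 2)) (homCounts-h r) ⟩
    neighbourSums neighbourhoods (_^ 2) (Vec.tabulate (h G r))
      ≡⟨ neighbourSums-tabulate (_^ 2) (h G r) ⟩
    Vec.tabulate (λ x → ∑ (N x) (λ z → h G r z ^ 2))
      ≡⟨ Vec.tabulate-cong (λ x → sym (h-suc G r x)) ⟩
    Vec.tabulate (h G (suc r)) ∎
    where open ≡-Reasoning

∑-homCounts : ∀ G r → Vec.sum (homCounts G r) ≡ ∑ (Graph.vertices G) (h G r)
∑-homCounts G r = trans (cong Vec.sum (homCounts-h G r)) (sum-tabulate (h G r) id)
  where
  sum-tabulate : ∀ {n} (f : A → ℕ) (g : Fin n → A) → Vec.sum (Vec.tabulate (f ∘ g)) ≡ ∑ (tabulate g) f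
  sum-tabulate {n = zero}  f g = refl
  sum-tabulate {n = suc n} f g = cong (f (g zero) +_) (sum-tabulate f (g ∘ suc))

-- Certifying equality of ω-colors

-- The shift by 2 is the lead of ω over color refinement on these graphs.
code : (G : Graph) → ℕ → Vec ℕ (Graph.order G)
code G r = homCounts G (2 + r)

row : ∀ {n} → Table (List ℕ) n → Vec ℕ n → Fin n → List (List ℕ × ℕ)
row t a x = map (λ z → entry t x z , lookup a z) (allFin _)

row-≟ : DecidableEquality (List ℕ × ℕ)
row-≟ (as , a) (bs , b) =
  map′ (uncurry (cong₂ _,_)) Product.,-injective (List.≡-dec ℕ._≟_ as bs ×-dec a ℕ.≟ b)

module _ {m n} (s : Table (List ℕ) m) (t : Table (List ℕ) n) where

  ClosedWalksMatch : (a : Vec ℕ m) (b : Vec ℕ n) → Set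
  ClosedWalksMatch a b = ∀ x y → lookup a x ≡ lookup b y → entry s x x ≡ entry t y y

  closedWalksMatch? : ∀ a b → Dec (ClosedWalksMatch a b)
  closedWalksMatch? a b = all? λ x → all? λ y →
    (lookup a x ℕ.≟ lookup b y) →-dec List.≡-dec ℕ._≟_ (entry s x x) (entry t y y)

  -- One round of the recursion of `ω`, with colors replaced by codes so that it can be checked by
  -- evaluation. Only vertices of different graphs are compared, which is all that matching their
  -- multisets requires.
  Refines : (a a′ : Vec ℕ m) (b b′ : Vec ℕ n) → Set
  Refines a a′ b b′ = ∀ x y → lookup a′ x ≡ lookup b′ y →
    lookup a x ≡ lookup b y × T (isPermutation row-≟ (row s a x) (row t b y))

  refines? : ∀ a a′ b b′ → Dec (Refines a a′ b b′)
  refines? a a′ b b′ = all? λ x → all? λ y →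
    (lookup a′ x ℕ.≟ lookup b′ y) →-dec ((lookup a x ℕ.≟ lookup b y) ×-dec
      T? (isPermutation row-≟ (row s a x) (row t b y)))

  Certificate : (a : ℕ → Vec ℕ m) (b : ℕ → Vec ℕ n) → Set
  Certificate a b =
    ClosedWalksMatch (a 0) (b 0) × Refines (a 0) (a 1) (b 0) (b 1) × Refines (a 1) (a 2) (b 1) (b 2) ×
    T (isPermutation ℕ._≟_ (map (lookup (a 2)) (allFin m)) (map (lookup (b 2)) (allFin n)))

  certificate? : ∀ a b → Dec (Certificate a b)
  certificate? a b =
    closedWalksMatch? (a 0) (b 0) ×-dec refines? (a 0) (a 1) (b 0) (b 1) ×-dec
    refines? (a 1) (a 2) (b 1) (b 2) ×-dec
    T? (isPermutation ℕ._≟_ (map (lookup (a 2)) (allFin m)) (map (lookup (b 2)) (allFin n)))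

module _ (G H : Graph) where

  Simulates : ∀ r → Vec ℕ (Graph.order G) → Vec ℕ (Graph.order H) → Set
  Simulates r a b = ∀ x y → lookup a x ≡ lookup b y → Setoid._≈_ (ω-setoid r) (ω G r x) (ω H r y)

  closedWalksMatch⇒simulates : ∀ a b → ClosedWalksMatch (walks G) (walks H) a b → Simulates 0 a b
  closedWalksMatch⇒simulates a b c x y eq = trans (sym (walks-w⋆ G x x)) (trans (c x y eq) (walks-w⋆ H y y))

  -- Matched row entries have equal walk vectors and equal codes, hence by `sim` equal colors of
  -- round `r`.
  refines⇒simulates : ∀ r a a′ b b′ → Refines (walks G) (walks H) a a′ b b′ →
    Simulates r a b → Simulates (suc r) a′ b′
  refines⇒simulates r a a′ b b′ ref sim x y eq with eq′ , p ← ref x y eq =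
    sim x y eq′ ,
    map-↭-transport (≡.setoid (List ℕ) ×ₛ ω-setoid r) _ _ _ _
      (λ z z′ e → trans (sym (walks-w⋆ G x z)) (trans (cong proj₁ e) (walks-w⋆ H y z′)) , sim z z′ (cong proj₂ e))
      (isPermutation⇒↭ row-≟ _ _ p)

  certificate⇒≈ω : ∀ a b → Certificate (walks G) (walks H) a b → G ≈ω⁽ 2 ⁾ H
  certificate⇒≈ω a b (c , r₁ , r₂ , p) =
    map-↭-transport (ω-setoid 2) (lookup (a 2)) (lookup (b 2)) (ω G 2) (ω H 2)
      (refines⇒simulates 1 (a 1) (a 2) (b 1) (b 2) r₂
        (refines⇒simulates 0 (a 0) (a 1) (b 0) (b 1) r₁
          (closedWalksMatch⇒simulates (a 0) (b 0) c)))
      (isPermutation⇒↭ ℕ._≟_ _ _ p)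

-- The two graphs

Pair : Set
Pair = ℕ × ℕ

K₇ : Vec Pair 21
K₇ = (0 , 1) Vec.∷ (0 , 2) Vec.∷ (0 , 3) Vec.∷ (0 , 4) Vec.∷ (0 , 5) Vec.∷ (0 , 6) Vec.∷
     (1 , 2) Vec.∷ (1 , 3) Vec.∷ (1 , 4) Vec.∷ (1 , 5) Vec.∷ (1 , 6) Vec.∷
     (2 , 3) Vec.∷ (2 , 4) Vec.∷ (2 , 5) Vec.∷ (2 , 6) Vec.∷
     (3 , 4) Vec.∷ (3 , 5) Vec.∷ (3 , 6) Vec.∷
     (4 , 5) Vec.∷ (4 , 6) Vec.∷
     (5 , 6) Vec.∷ Vec.[]

-- For a < b and c < d: the pairs share exactly one point.
incident : Pair → Pair → Bool
incident (a , b) (c , d) = ((a ≡ᵇ c) xor (b ≡ᵇ d)) ∨ (a ≡ᵇ d) ∨ (b ≡ᵇ c)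

infix 4 _∈ᵇ_
-- Comparing ordered pairs suffices because `K₇` and the lists below write the smaller point first.
_∈ᵇ_ : Pair → List Pair → Bool
(a , b) ∈ᵇ F = any (λ (c , d) → (a ≡ᵇ c) ∧ (b ≡ᵇ d)) F

-- The vertex zero is the apex.
adjacent : List Pair → Fin 22 → Fin 22 → Bool
adjacent F zero    zero    = false
adjacent F zero    (suc e) = lookup K₇ e ∈ᵇ F
adjacent F (suc e) zero    = lookup K₇ e ∈ᵇ F
adjacent F (suc e) (suc f) = incident (lookup K₇ e) (lookup K₇ f)

incident-sym : ∀ e f → incident (lookup K₇ e) (lookup K₇ f) ≡ incident (lookup K₇ f) (lookup K₇ e)
incident-sym = toWitness
  {a? = all? λ e → all? λ f → incident (lookup K₇ e) (lookup K₇ f) Bool.≟ incident (lookup K₇ f) (lookup K₇ e)} tt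

incident-irrefl : ∀ e → incident (lookup K₇ e) (lookup K₇ e) ≡ false
incident-irrefl = toWitness {a? = all? λ e → incident (lookup K₇ e) (lookup K₇ e) Bool.≟ false} tt

-- The cases that involve `F` are symmetric by definition, so one finite check serves every `F`.
adjacent-sym : ∀ F x y → adjacent F x y ≡ adjacent F y x
adjacent-sym F zero    zero    = refl
adjacent-sym F zero    (suc f) = refl
adjacent-sym F (suc e) zero    = refl
adjacent-sym F (suc e) (suc f) = incident-sym e f

adjacent-irrefl : ∀ F x → adjacent F x x ≡ false
adjacent-irrefl F zero    = refl
adjacent-irrefl F (suc e) = incident-irrefl e

apexed : List Pair → Graph
apexed F = record
  { order    = 22
  ; _~_      = λ x y → T (adjacent F x y)
  ; _~?_     = λ x y → T? (adjacent F x y)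
  ; ~-sym    = λ {x} {y} → subst T (adjacent-sym F x y)
  ; ~-irrefl = λ { {x} refl → subst T (adjacent-irrefl F x) }
  }

-- Triangle 0 1 2 and square 3 4 5 6, joined by the bridge 03.
bridgedCycles : Graph
bridgedCycles = apexed ((0 , 1) ∷ (1 , 2) ∷ (0 , 2) ∷ (0 , 3) ∷ (3 , 4) ∷ (4 , 5) ∷ (5 , 6) ∷ (3 , 6) ∷ [])

-- The cycle 0 1 2 3 4 5 6 with the chord 03: the edges 02 and 36 of the previous list are switched
-- to 23 and 06, which preserves all degrees.
chordedCycle : Graph
chordedCycle = apexed ((0 , 1) ∷ (1 , 2) ∷ (2 , 3) ∷ (0 , 3) ∷ (3 , 4) ∷ (4 , 5) ∷ (5 , 6) ∷ (0 , 6) ∷ [])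

-- Evaluation of the invariants and conclusion

homCounts₆-differ : Vec.sum (homCounts bridgedCycles 6) ≢ Vec.sum (homCounts chordedCycle 6)
homCounts₆-differ = from-no (Vec.sum (homCounts bridgedCycles 6) ℕ.≟ Vec.sum (homCounts chordedCycle 6))

certificate : Certificate (walks bridgedCycles) (walks chordedCycle) (code bridgedCycles) (code chordedCycle)
certificate = toWitness
  {a? = certificate? (walks bridgedCycles) (walks chordedCycle) (code bridgedCycles) (code chordedCycle)} tt

theorem6p2 : ∃₂ λ (G H : Graph) → (G ≈ω⁽ 2 ⁾ H) × ¬ (G ≈WL₁ H)
theorem6p2 = bridgedCycles , chordedCycle ,
  certificate⇒≈ω bridgedCycles chordedCycle (code bridgedCycles) (code chordedCycle) certificate , λ p →
  homCounts₆-differ (begin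
    Vec.sum (homCounts bridgedCycles 6)
      ≡⟨ ∑-homCounts bridgedCycles 6 ⟩
    ∑ (Graph.vertices bridgedCycles) (h bridgedCycles 6)
      -- Of the 22 rounds of `WL₁`, the last 16 are undone to reach round 6.
      ≡⟨ WL₁⇒∑h bridgedCycles chordedCycle 16 6 refl refl p ⟩
    ∑ (Graph.vertices chordedCycle) (h chordedCycle 6)
      ≡⟨ ∑-homCounts chordedCycle 6 ⟨
    Vec.sum (homCounts chordedCycle 6) ∎)
  where open ≡-Reasoning
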